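{- Let $\mathcal{F}=(W,\leq,Y_0)$ be a sub-normal frame. Define relations on $W$, for all $x,y\in W$, by (A) $xR_{N_1}y$ iff $\exists z\in W(x\leq z\ \&\ y\leq z)$; (B) $xR_{N_2}y$ iff $\exists z\in W(x\leq z\ \&\ y\leq z\ \&\ z\notin Y_0)$. Then: 1. $Y_0=\{z\in W: \text{there is no } x\in W \text{ with } zR_{N_2}x\}$. 2. $\Phi(\mathcal{F}):=(W,\leq,R_{N_1},R_{N_2})$ is an $\hat N$-frame. If $\mathcal{F}$ is a sub-normal identity frame, then $\Phi(\mathcal{F})$ is an $\hat N'$-frame. 3. If $v$ is a valuation on $\mathcal{F}$, then $v$ is a valuation on $\Phi(\mathcal{F})$ such that for all $\alpha\in F$ and $x\in W$: (a) $(\mathcal{F},v),x\vDash\alpha\Leftrightarrow(\Phi(\mathcal{F}),v),x\vDash\alpha$; (b) $(\mathcal{F},v)\vDash\alpha\Leftrightarrow(\Phi(\mathcal{F}),v)\vDash\alpha$; (c) $\mathcal{F}\vDash\alpha\Leftrightarrow\Phi(\mathcal{F})\vDash\alpha$.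
   Context: $F$ is the set of formulas built from propositional variables and constants $\top,\bot$ with $\wedge,\vee,\rightarrow,\neg,\sim$. A sub-normal frame is $(W,\leq,Y_0)$ with $(W,\leq)$ a nonempty poset and $Y_0\subseteq W$ an upset such that for all $x\in W$: if for every $y\geq x$ there is $z\geq y$ with $z\in Y_0$, then $x\in Y_0$. It is a sub-normal identity frame if moreover for all $x,y\in W\setminus Y_0$, $x\leq y$ implies $y\leq x$. A strictly condensed $J$-frame is a triple $(X,\leq,R_N)$ with $(X,\leq)$ a poset and $R_N$ a binary relation on $X$ such that: (i) $x\leq x'$, $x'R_Ny'$, $y\leq y'$ imply $xR_Ny$; (ii) $R_N$ is symmetric; (iii) $\forall x,y\,(xR_Ny\Rightarrow\exists z(x\leq z\ \&\ y\leq z\ \&\ xR_Nz))$. It is a strictly condensed $H$-frame if moreover $R_N$ is reflexive. An $\hat N$-frame is $(X,\leq,R_{N_1},R_{N_2})$ such that (1) $(X,\leq,R_{N_1})$ is a strictly condensed $H$-frame; (2) $(X,\leq,R_{N_2})$ is a strictly condensed $J$-frame; (3) for all $x\in X$: if for every $y$ with $xR_{N_1}y$ there is $z$ with $yR_{N_1}z$ and no $z'$ with $zR_{N_2}z'$, then there is no $z''$ with $xR_{N_2}z''$. An $\hat N'$-frame is an $\hat N$-frame such that $xR_{N_2}y$ implies $y\leq x$. On either kind of frame, a valuation assigns an upset to each propositional variable. Truth: variables via $v$; $\top$ everywhere, $\bot$ nowhere; $\wedge,\vee$ pointwise; $x\vDash\alpha\rightarrow\beta$ iff for all $y\geq x$,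 $y\vDash\alpha$ implies $y\vDash\beta$. On sub-normal frames: $x\vDash\neg\alpha$ iff for all $y\geq x$, $y\nvDash\alpha$; $x\vDash\sim\alpha$ iff for all $y\geq x$, $y\vDash\alpha$ implies $y\in Y_0$. On $\hat N$-frames: $x\vDash\neg\alpha$ iff for all $y$, $xR_{N_1}y$ implies $y\nvDash\alpha$; $x\vDash\sim\alpha$ iff for all $y$, $xR_{N_2}y$ implies $y\nvDash\alpha$. $(\mathcal{F},v)\vDash\alpha$ means truth at all points; $\mathcal{F}\vDash\alpha$ means truth at all points under all valuations. -}

module Defs where

open import Data.Empty.Polymorphic using (⊥)
open import Data.Product using (_×_; ∃-syntax)
open import Data.Sum using (_⊎_)
open import Data.Unit.Polymorphic using (⊤)
open import Level using (Level; suc)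
open import Relation.Binary.Bundles using (Poset)
open import Relation.Binary.Core using (Rel)
open import Relation.Binary.Definitions using (Reflexive; Symmetric; _Respects_)
open import Relation.Nullary using (¬_)
open import Relation.Unary using (Pred; _∈_; _∉_)

infixr 7 _`∧_
infixr 6 _`∨_
infixr 5 _`→_
infixr 8 `¬_ `∼_

data Formula (Var : Set) : Set where
  var            : Var → Formula Var
  `⊤ `⊥          : Formula Var
  _`∧_ _`∨_ _`→_ : Formula Var → Formula Var → Formula Var
  `¬_ `∼_        : Formula Var → Formula Var

-- For a subset S of a poset, `S Respects _≤_` says that S is an upset; in
-- particular S is then closed under the poset's setoid equality.

record SubNormalFrame (ℓ : Level) : Set (suc ℓ) where
  field
    poset : Poset ℓ ℓ ℓ

  open Poset poset public using (_≤_) renaming (Carrier to W)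

  field
    nonempty : W
    Y₀       : Pred W ℓ
    Y₀-upset : Y₀ Respects _≤_
    Y₀-dense : ∀ x → (∀ y → x ≤ y → ∃[ z ] (y ≤ z × z ∈ Y₀)) → x ∈ Y₀

IsIdentityFrame : ∀ {ℓ} → SubNormalFrame ℓ → Set ℓ
IsIdentityFrame F = ∀ x y → x ∉ Y₀ → y ∉ Y₀ → x ≤ y → y ≤ x
  where open SubNormalFrame F

module _ {ℓ : Level} (X : Poset ℓ ℓ ℓ) where
  open Poset X using (Carrier; _≤_)

  record IsStrictlyCondensedJFrame (R : Rel Carrier ℓ) : Set ℓ where
    field
      condensed : ∀ x x' y y' → x ≤ x' → R x' y' → y ≤ y' → R x y
      symmetric : Symmetric R
      strict    : ∀ x y → R x y → ∃[ z ] (x ≤ z × y ≤ z × R x z)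

  record IsStrictlyCondensedHFrame (R : Rel Carrier ℓ) : Set ℓ where
    field
      isStrictlyCondensedJFrame : IsStrictlyCondensedJFrame R
      reflexive                 : Reflexive R

-- The bare data (X , ≤ , R_N₁ , R_N₂), on which being an N̂-frame is a property.
record BiStructure (ℓ : Level) : Set (suc ℓ) where
  field
    poset : Poset ℓ ℓ ℓ

  open Poset poset public using (_≤_) renaming (Carrier to X)

  field
    R₁ R₂ : Rel X ℓ

record IsN̂Frame {ℓ} (G : BiStructure ℓ) : Set ℓ where
  open BiStructure G
  field
    R₁-isHFrame : IsStrictlyCondensedHFrame poset R₁
    R₂-isJFrame : IsStrictlyCondensedJFrame poset R₂
    R₁-R₂       : ∀ x →
                  (∀ y → R₁ x y → ∃[ z ] (R₁ y z × ¬ (∃[ z' ] R₂ z z'))) →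
                  ¬ (∃[ z'' ] R₂ x z'')

record IsN̂′Frame {ℓ} (G : BiStructure ℓ) : Set ℓ where
  open BiStructure G
  field
    isN̂Frame : IsN̂Frame G
    R₂⇒≥     : ∀ x y → R₂ x y → y ≤ x

IsValuation : ∀ {ℓ} {Var : Set} (P : Poset ℓ ℓ ℓ) →
              (Var → Pred (Poset.Carrier P) ℓ) → Set ℓ
IsValuation P v = ∀ p → v p Respects Poset._≤_ P

-- Truth at a point, truth at all points, and validity.  The superscript s
-- marks sub-normal frames, the superscript n marks (N̂-frame) structures.

module _ {ℓ : Level} {Var : Set} (F : SubNormalFrame ℓ) where
  open SubNormalFrame F

  infix 4 _[_]_⊨ˢ_ _[_]⊨ˢ_ _⊨ˢ_

  _[_]_⊨ˢ_ : (Var → Pred W ℓ) → W → Formula Var → Set ℓ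
  _[_]_⊨ˢ_ v x (var p)  = x ∈ v p
  _[_]_⊨ˢ_ v x `⊤       = ⊤
  _[_]_⊨ˢ_ v x `⊥       = ⊥
  _[_]_⊨ˢ_ v x (α `∧ β) = _[_]_⊨ˢ_ v x α × _[_]_⊨ˢ_ v x β
  _[_]_⊨ˢ_ v x (α `∨ β) = _[_]_⊨ˢ_ v x α ⊎ _[_]_⊨ˢ_ v x β
  _[_]_⊨ˢ_ v x (α `→ β) = ∀ y → x ≤ y → _[_]_⊨ˢ_ v y α → _[_]_⊨ˢ_ v y β
  _[_]_⊨ˢ_ v x (`¬ α)   = ∀ y → x ≤ y → ¬ (_[_]_⊨ˢ_ v y α)
  _[_]_⊨ˢ_ v x (`∼ α)   = ∀ y → x ≤ y → _[_]_⊨ˢ_ v y α → y ∈ Y₀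

  _[_]⊨ˢ_ : (Var → Pred W ℓ) → Formula Var → Set ℓ
  _[_]⊨ˢ_ v α = ∀ x → _[_]_⊨ˢ_ v x α

  _⊨ˢ_ : Formula Var → Set (suc ℓ)
  _⊨ˢ_ α = ∀ v → IsValuation poset v → _[_]⊨ˢ_ v α

module _ {ℓ : Level} {Var : Set} (G : BiStructure ℓ) where
  open BiStructure G

  infix 4 _[_]_⊨ⁿ_ _[_]⊨ⁿ_ _⊨ⁿ_

  _[_]_⊨ⁿ_ : (Var → Pred X ℓ) → X → Formula Var → Set ℓ
  _[_]_⊨ⁿ_ v x (var p)  = x ∈ v p
  _[_]_⊨ⁿ_ v x `⊤       = ⊤
  _[_]_⊨ⁿ_ v x `⊥       = ⊥
  _[_]_⊨ⁿ_ v x (α `∧ β) = _[_]_⊨ⁿ_ v x α × _[_]_⊨ⁿ_ v x β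
  _[_]_⊨ⁿ_ v x (α `∨ β) = _[_]_⊨ⁿ_ v x α ⊎ _[_]_⊨ⁿ_ v x β
  _[_]_⊨ⁿ_ v x (α `→ β) = ∀ y → x ≤ y → _[_]_⊨ⁿ_ v y α → _[_]_⊨ⁿ_ v y β
  _[_]_⊨ⁿ_ v x (`¬ α)   = ∀ y → R₁ x y → ¬ (_[_]_⊨ⁿ_ v y α)
  _[_]_⊨ⁿ_ v x (`∼ α)   = ∀ y → R₂ x y → ¬ (_[_]_⊨ⁿ_ v y α)

  _[_]⊨ⁿ_ : (Var → Pred X ℓ) → Formula Var → Set ℓ
  _[_]⊨ⁿ_ v α = ∀ x → _[_]_⊨ⁿ_ v x α

  _⊨ⁿ_ : Formula Var → Set (suc ℓ)
  _⊨ⁿ_ α = ∀ v → IsValuation poset v → _[_]⊨ⁿ_ v α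

Φ : ∀ {ℓ} → SubNormalFrame ℓ → BiStructure ℓ
Φ F = record
  { poset = poset
  ; R₁    = λ x y → ∃[ z ] (x ≤ z × y ≤ z)
  ; R₂    = λ x y → ∃[ z ] (x ≤ z × y ≤ z × z ∉ Y₀)
  }
  where open SubNormalFrame F

{-# OPTIONS --safe #-}
-- By persistence along ≤, the truth of a formula at y carries over to any common
-- upper bound z of x and y, where the clauses for ¬ and ∼ over points above x apply;
-- conversely any y ≥ x is itself such an upper bound.  Density of Y₀ yields the
-- compatibility of R₁ with R₂, since an R₂-isolated z lies in Y₀ and hence so
-- does every upper bound of z.

module Submission where

open import Axiom.DoubleNegationElimination using (em⇒dne)
open import Axiom.ExcludedMiddle using (ExcludedMiddle)
open import Data.Product using (_×_; ∃-syntax; _,_; proj₁; proj₂) renaming (map to map-×)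
open import Data.Product.Function.NonDependent.Propositional using (_×-⇔_)
open import Data.Sum using () renaming (map to map-⊎)
open import Data.Sum.Function.Propositional using (_⊎-⇔_)
open import Function.Base using (id; _∘_)
open import Function.Bundles using (_⇔_; mk⇔; module Equivalence)
open import Level using (Level)
open import Relation.Binary.Bundles using (Poset)
open import Relation.Binary.Definitions using (_Respects_)
open import Relation.Nullary using (¬_)
open import Relation.Unary using (Pred; _≐_)
open import Defs

open Equivalence using (to; from)

module _ {ℓ : Level} (em : ExcludedMiddle ℓ) (F : SubNormalFrame ℓ) where
  open SubNormalFrame F
  open Poset poset using (refl; trans)
  open BiStructure (Φ F) using (R₂)

  -- An upset containing `z` contains every upper bound of `z`, leaving none to witness `R₂`.
  -- Conversely, a point outside `Y₀` is `R₂`-related to itself, so isolation refutes `z ∉ Y₀`;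
  -- excluded middle removes the double negation.
  Y₀≐R₂-isolated : Y₀ ≐ (λ z → ¬ (∃[ x ] R₂ z x))
  Y₀≐R₂-isolated =
      (λ z∈Y₀ (_ , _ , z≤w , _ , w∉Y₀) → w∉Y₀ (Y₀-upset z≤w z∈Y₀))
    , (λ {z} isolated → em⇒dne em λ z∉Y₀ → isolated (z , z , refl , refl , z∉Y₀))

  Φ-isN̂Frame : IsN̂Frame (Φ F)
  Φ-isN̂Frame = record
    { R₁-isHFrame = record
      { isStrictlyCondensedJFrame = record
        { condensed = λ _ _ _ _ x≤x' (z , x'≤z , y'≤z) y≤y' →
            z , trans x≤x' x'≤z , trans y≤y' y'≤z
        ; symmetric = λ (z , x≤z , y≤z) → z , y≤z , x≤z
        -- The common upper bound `z` of `x` and `y` also bounds `x` and itself.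
        ; strict    = λ _ _ (z , x≤z , y≤z) → z , x≤z , y≤z , z , x≤z , refl
        }
      ; reflexive = λ {x} → x , refl , refl
      }
    ; R₂-isJFrame = record
      { condensed = λ _ _ _ _ x≤x' (z , x'≤z , y'≤z , z∉Y₀) y≤y' →
          z , trans x≤x' x'≤z , trans y≤y' y'≤z , z∉Y₀
      ; symmetric = λ (z , x≤z , y≤z , z∉Y₀) → z , y≤z , x≤z , z∉Y₀
      ; strict    = λ _ _ (z , x≤z , y≤z , z∉Y₀) → z , x≤z , y≤z , z , x≤z , refl , z∉Y₀
      }
    -- Each `y ≥ x` is `R₁`-related to `x`, so `h` gives an isolated `z` sharing an upper bound `w`
    -- with `y`. This `w` is the point of `Y₀` above `y` that density asks for.
    ; R₁-R₂ = λ x h → proj₁ Y₀≐R₂-isolated (Y₀-dense x λ y x≤y →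
        let z , (w , y≤w , z≤w) , isolated = h y (y , x≤y , refl)
        in w , y≤w , Y₀-upset z≤w (proj₂ Y₀≐R₂-isolated isolated))
    }

  Φ-isN̂′Frame : IsIdentityFrame F → IsN̂′Frame (Φ F)
  Φ-isN̂′Frame identity = record
    { isN̂Frame = Φ-isN̂Frame
    ; R₂⇒≥     = λ x y (z , x≤z , y≤z , z∉Y₀) →
        -- As `z` avoids the upset `Y₀`, so does `x` below it; the identity condition then gives
        -- `z ≤ x`.
        trans y≤z (identity x z (z∉Y₀ ∘ Y₀-upset x≤z) z∉Y₀ x≤z)
    }

  module _ {Var : Set} (v : Var → Pred W ℓ) (v-upset : IsValuation poset v) where

    ⊨ˢ-upset : ∀ α → (λ x → F [ v ] x ⊨ˢ α) Respects _≤_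
    ⊨ˢ-upset (var p)  x≤y = v-upset p x≤y
    ⊨ˢ-upset `⊤       x≤y = id
    ⊨ˢ-upset `⊥       x≤y = id
    ⊨ˢ-upset (α `∧ β) x≤y = map-× (⊨ˢ-upset α x≤y) (⊨ˢ-upset β x≤y)
    ⊨ˢ-upset (α `∨ β) x≤y = map-⊎ (⊨ˢ-upset α x≤y) (⊨ˢ-upset β x≤y)
    ⊨ˢ-upset (α `→ β) x≤y h z y≤z = h z (trans x≤y y≤z)
    ⊨ˢ-upset (`¬ α)   x≤y h z y≤z = h z (trans x≤y y≤z)
    ⊨ˢ-upset (`∼ α)   x≤y h z y≤z = h z (trans x≤y y≤z)

    -- Induction on `α` for all points at once, since the clauses for `→`, `¬` and `∼` evaluate
    -- subformulas at points other than `x`.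
    ⊨ˢ⇔⊨ⁿ : ∀ α x → (F [ v ] x ⊨ˢ α) ⇔ (Φ F [ v ] x ⊨ⁿ α)
    ⊨ˢ⇔⊨ⁿ (var p)  x = mk⇔ id id
    ⊨ˢ⇔⊨ⁿ `⊤       x = mk⇔ id id
    ⊨ˢ⇔⊨ⁿ `⊥       x = mk⇔ id id
    ⊨ˢ⇔⊨ⁿ (α `∧ β) x = ⊨ˢ⇔⊨ⁿ α x ×-⇔ ⊨ˢ⇔⊨ⁿ β x
    ⊨ˢ⇔⊨ⁿ (α `∨ β) x = ⊨ˢ⇔⊨ⁿ α x ⊎-⇔ ⊨ˢ⇔⊨ⁿ β x
    ⊨ˢ⇔⊨ⁿ (α `→ β) x = mk⇔
      (λ h y x≤y → to (⊨ˢ⇔⊨ⁿ β y) ∘ h y x≤y ∘ from (⊨ˢ⇔⊨ⁿ α y))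
      (λ h y x≤y → from (⊨ˢ⇔⊨ⁿ β y) ∘ h y x≤y ∘ to (⊨ˢ⇔⊨ⁿ α y))
    ⊨ˢ⇔⊨ⁿ (`¬ α)   x = mk⇔
      (λ h y (z , x≤z , y≤z) → h z x≤z ∘ ⊨ˢ-upset α y≤z ∘ from (⊨ˢ⇔⊨ⁿ α y))
      (λ h y x≤y → h y (y , x≤y , refl) ∘ to (⊨ˢ⇔⊨ⁿ α y))
    ⊨ˢ⇔⊨ⁿ (`∼ α)   x = mk⇔
      (λ h y (z , x≤z , y≤z , z∉Y₀) → z∉Y₀ ∘ h z x≤z ∘ ⊨ˢ-upset α y≤z ∘ from (⊨ˢ⇔⊨ⁿ α y))
      -- If `y` lay outside `Y₀`, it would itself witness `R₂ x y`, and `h` would refute `α` at `y`.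
      (λ h y x≤y y⊨α → em⇒dne em λ y∉Y₀ →
        h y (y , x≤y , refl , y∉Y₀) (to (⊨ˢ⇔⊨ⁿ α y) y⊨α))

    ⊨ˢ⇔⊨ⁿ-global : ∀ α → (F [ v ]⊨ˢ α) ⇔ (Φ F [ v ]⊨ⁿ α)
    ⊨ˢ⇔⊨ⁿ-global α = mk⇔
      (λ h x → to (⊨ˢ⇔⊨ⁿ α x) (h x))
      (λ h x → from (⊨ˢ⇔⊨ⁿ α x) (h x))

  -- `Φ` keeps the poset, so both sides quantify over the same valuations.
  ⊨ˢ⇔⊨ⁿ-valid : ∀ {Var : Set} (α : Formula Var) → (F ⊨ˢ α) ⇔ (Φ F ⊨ⁿ α)
  ⊨ˢ⇔⊨ⁿ-valid α = mk⇔
    (λ h v v-upset → to (⊨ˢ⇔⊨ⁿ-global v v-upset α) (h v v-upset))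
    (λ h v v-upset → from (⊨ˢ⇔⊨ⁿ-global v v-upset α) (h v v-upset))

theorem5p4 : ∀ {ℓ} → ExcludedMiddle ℓ → (Var : Set) (F : SubNormalFrame ℓ) →
    (SubNormalFrame.Y₀ F ≐ (λ z → ¬ (∃[ x ] BiStructure.R₂ (Φ F) z x)))
    × (IsN̂Frame (Φ F) × (IsIdentityFrame F → IsN̂′Frame (Φ F)))
    × ((v : Var → Pred (SubNormalFrame.W F) ℓ) → IsValuation (SubNormalFrame.poset F) v →
        IsValuation (BiStructure.poset (Φ F)) v
        × (∀ α x → (F [ v ] x ⊨ˢ α) ⇔ (Φ F [ v ] x ⊨ⁿ α))
        × (∀ α → (F [ v ]⊨ˢ α) ⇔ (Φ F [ v ]⊨ⁿ α)))
    × ((α : Formula Var) → (F ⊨ˢ α) ⇔ (Φ F ⊨ⁿ α))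
theorem5p4 em Var F =
    Y₀≐R₂-isolated em F
  , (Φ-isN̂Frame em F , Φ-isN̂′Frame em F)
  , (λ v v-upset → v-upset , ⊨ˢ⇔⊨ⁿ em F v v-upset , ⊨ˢ⇔⊨ⁿ-global em F v v-upset)
  , ⊨ˢ⇔⊨ⁿ-valid em F
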